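{- Let $p\ge 1$ and let $G=C_5^p$. Then $G$ is near graceful when $p\equiv 1,2 \pmod 4$ and $G$ is graceful when $p\equiv 0,3\pmod 4$.
   Context: $C_n^p$ denotes the graph obtained from the union of $p$ cycles of length $n$ sharing exactly one common vertex (the central vertex). For a graph $G$ with $m$ edges, a graceful labelling is an injective map $f:V(G)\to\{0,1,\ldots,m\}$ such that the induced edge labelling $g(uv)=|f(u)-f(v)|$ is a bijection onto $\{1,\ldots,m\}$. A near graceful labelling is an injective map $f:V(G)\to\{0,1,\ldots,m+1\}$ such that $g(uv)=|f(u)-f(v)|$ is a bijection onto $A$, where $A$ is $\{1,\ldots,m-1,m\}$ or $\{1,\ldots,m-1,m+1\}$. A graph is (near) graceful if it has a (near) graceful labelling. -}

module Defs where

open import Data.Nat using (ℕ; zero; suc; _+_; _*_; _≤_; ∣_-_∣)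
open import Data.Fin using (Fin; zero; suc; remQuot)
open import Data.Product using (_×_; _,_; Σ; ∃)
open import Data.Sum using (_⊎_)
open import Relation.Binary.PropositionalEquality using (_≡_)
open import Function.Definitions using (Injective)

record Graph : Set₁ where
  field
    V     : Set
    m     : ℕ
    ends  : Fin m → V × V

open Graph public

edgeLabel : (G : Graph) → (V G → ℕ) → Fin (m G) → ℕ
edgeLabel G f e with ends G e
... | (u , v) = ∣ f u - f v ∣

BijOnto : {k : ℕ} → (Fin k → ℕ) → (ℕ → Set) → Set
BijOnto g A = Injective _≡_ _≡_ g
            × (∀ e → A (g e))
            × (∀ a → A a → ∃ λ e → g e ≡ a)

IsGracefulLabelling : (G : Graph) → (V G → ℕ) → Set
IsGracefulLabelling G f =
    Injective _≡_ _≡_ f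
  × (∀ v → f v ≤ m G)
  × BijOnto (edgeLabel G f) (λ a → 1 ≤ a × a ≤ m G)

Graceful : Graph → Set
Graceful G = Σ (V G → ℕ) (IsGracefulLabelling G)

SetA₁ SetA₂ : ℕ → ℕ → Set
SetA₁ m a = 1 ≤ a × a ≤ m
SetA₂ m a = (1 ≤ a × suc a ≤ m) ⊎ a ≡ suc m

IsNearGracefulLabelling : (G : Graph) → (V G → ℕ) → Set
IsNearGracefulLabelling G f =
    Injective _≡_ _≡_ f
  × (∀ v → f v ≤ suc (m G))
  × (BijOnto (edgeLabel G f) (SetA₁ (m G)) ⊎ BijOnto (edgeLabel G f) (SetA₂ (m G)))

NearGraceful : Graph → Set
NearGraceful G = Σ (V G → ℕ) (IsNearGracefulLabelling G)

-- The graph C_5^p: p cycles of length 5 sharing exactly one vertex (the centre).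
-- Vertices: the centre, and for each cycle i < p four further vertices vtx i 0..3.
data C5Vert (p : ℕ) : Set where
  center : C5Vert p
  vtx    : Fin p → Fin 4 → C5Vert p

c5Edge : {p : ℕ} → Fin p → Fin 5 → C5Vert p × C5Vert p
c5Edge i zero                      = center , vtx i zero
c5Edge i (suc zero)                = vtx i zero , vtx i (suc zero)
c5Edge i (suc (suc zero))          = vtx i (suc zero) , vtx i (suc (suc zero))
c5Edge i (suc (suc (suc zero)))    = vtx i (suc (suc zero)) , vtx i (suc (suc (suc zero)))
c5Edge i (suc (suc (suc (suc zero)))) = vtx i (suc (suc (suc zero))) , center

C5^ : ℕ → Graph
C5^ p = record
  { V    = C5Vert p
  ; m    = p * 5
  ; ends = λ e → let (i , j) = remQuot {p} 5 e in c5Edge i j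
  }

{-# OPTIONS --safe #-}
module Submission where

-- Put the label 0 at the centre.  For p ≥ 3, suppose that 1, …, 2p (if p ≡ 0, 3 mod 4) or
-- 1, …, 2p-1, 2p+1 (if p ≡ 1, 2 mod 4) are split into pairs {a, a+i} with i = 2, …, p+1: a perfect
-- or hooked Langford sequence of defect 2.  Shifted by 3p, these numbers label the neighbours of the
-- centre.  Closing a pair {A, D} of difference i < p by the path A, D-K, A-K, D with K = 2p+1 uses
-- the edges K-i, i, K+i, and the inner vertices inherit their distinctness from the pairs.
-- If the pair of difference p is {1, p+1} and that of difference p+1 ends at 2p (at 2p-1 in the
-- hooked case), two more pentagons on these pairs use exactly the edges that are left.
-- For p ≥ 20 such sequences are made of boundedly many nests of pairs, with ends linear in p
-- within each residue class mod 4.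

open import Defs
open import Data.Empty using (⊥; ⊥-elim)
open import Data.Fin using (Fin; zero; suc; toℕ; fromℕ<; #_; combine; punchIn; punchOut)
import Data.Fin.Properties as Fin
open import Data.List using (List; []; _∷_; _++_; length; lookup; map; concatMap; foldr; filter; upTo; applyUpTo)
open import Data.List.Membership.Propositional using (_∈_; lose)
open import Data.List.Membership.Propositional.Properties using (∈-map⁺; ∈-upTo⁺; ∈-applyUpTo⁺)
open import Data.List.Properties using (length-map; length-upTo; length-++)
open import Data.List.Relation.Unary.All as All using (All)
import Data.List.Relation.Unary.All.Properties as All
open import Data.List.Relation.Unary.Any as Any using (Any; here; there)
import Data.List.Relation.Unary.Any.Properties as Any
open import Data.Maybe as Maybe using (Maybe; just; nothing)
open import Data.Nat
open import Data.Nat.DivMod using (DivMod; _divMod_; result; [m+kn]%n≡m%n)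
open import Data.Nat.Properties
open import Data.List.Membership.DecPropositional _≟_ using (_∈?_)
open import Data.Nat.Tactic.RingSolver using (solve-∀)
open import Data.Product using (_×_; _,_; ∃; proj₁; proj₂; map₂; -,_)
open import Data.Sum using (_⊎_; inj₁; inj₂; [_,_]′)
open import Data.Sum.Function.Propositional using (_⊎-↔_)
open import Data.Vec as Vec using (Vec)
open import Function using (_∘_; Injection; _↣_)
open import Function.Construct.Composition using (_↔-∘_)
open import Function.Construct.Identity using (↔-id)
open import Function.Construct.Symmetry using (↔-sym)
open import Function.Definitions using (Injective)
open import Function.Properties.Inverse using (Inverse⇒Injection)
open import Relation.Binary.PropositionalEquality
open import Relation.Nullary using (Dec; yes; no; contradiction)
open import Relation.Nullary.Decidable using (True; toWitness; _⊎-dec_; _→-dec_; _×-dec_; ¬?)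

-- Pigeonhole

-- If `y` were missed, punching it out of the codomain would inject `Fin (suc n)` into `Fin n`.
injective⇒surjective : ∀ {n} {f : Fin n → Fin n} → Injective _≡_ _≡_ f → ∀ y → ∃ λ x → f x ≡ y
injective⇒surjective {zero}  _ ()
injective⇒surjective {suc n} {f} inj y with Fin.any? (λ x → f x Fin.≟ y)
... | yes hit = hit
... | no miss = ⊥-elim (1+n≰n (Fin.injective⇒≤ {f = λ x → punchOut (avoids x)} λ {i} {j} eq →
        inj (Fin.punchOut-injective (avoids i) (avoids j) eq)))
  where
  avoids : ∀ x → y ≢ f x
  avoids x eq = miss (x , sym eq)

module _ {n : ℕ} {I : Set} (ι : I ↣ Fin n) {g : I → ℕ} {h : Fin n → ℕ}
         (h-inj : Injective _≡_ _≡_ h) (onto : ∀ k → ∃ λ i → g i ≡ h k) where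

  private
    pick : Fin n → I
    pick k = proj₁ (onto k)

    pick-injective : Injective _≡_ _≡_ pick
    pick-injective {k} {l} eq =
      h-inj (trans (sym (proj₂ (onto k))) (trans (cong g eq) (proj₂ (onto l))))

    -- `pick` followed by `ι` is an injective self-map of `Fin n`, hence onto; cancelling `ι` shows
    -- that `pick` reaches all of `I`. So at most `n` indices covering `n` distinct values leave no
    -- index over and take no value twice.
    picked : ∀ i → ∃ λ k → pick k ≡ i
    picked i with injective⇒surjective (pick-injective ∘ Injection.injective ι) (Injection.to ι i)
    ... | k , eq = k , Injection.injective ι eq

  covering⇒values : ∀ i → ∃ λ k → g i ≡ h k
  covering⇒values i with picked i
  ... | k , refl = k , proj₂ (onto k)

  covering⇒injective : Injective _≡_ _≡_ g
  covering⇒injective {i} {j} eq with picked i | picked j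
  ... | k , refl | l , refl =
    cong pick (h-inj (trans (sym (proj₂ (onto k))) (trans eq (proj₂ (onto l)))))

1+toℕ : ∀ {x n} → x ≢ 0 → x ≤ n → ∃ λ (k : Fin n) → suc (toℕ k) ≡ x
1+toℕ {zero}  x≢0 _   = ⊥-elim (x≢0 refl)
1+toℕ {suc x} _   x<n = fromℕ< x<n , cong suc (Fin.toℕ-fromℕ< x<n)

-- Without `top` exactly `n` values remain, enumerated by `punchIn` around `top`, so `n` edges that
-- cover them hit each one once.
covering⇒bijOnto : ∀ {n top} (g : Fin n → ℕ) → top ≢ 0 → top ≤ suc n →
  (∀ x → 1 ≤ x → x ≤ suc n → x ≢ top → ∃ λ e → g e ≡ x) →
  BijOnto g (λ x → 1 ≤ x × x ≤ suc n × x ≢ top)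
covering⇒bijOnto {n} {top} g top≢0 top≤ onto with 1+toℕ top≢0 top≤
... | τ , refl = covering⇒injective Fin↣Fin {h = target} target-injective target-onto
               , (λ e → range (covering⇒values Fin↣Fin {h = target} target-injective target-onto e))
               , (λ { x (1≤x , x≤ , x≢) → onto x 1≤x x≤ x≢ })
  where
  Fin↣Fin : Fin n ↣ Fin n
  Fin↣Fin = Inverse⇒Injection (↔-id _)

  target : Fin n → ℕ
  target k = suc (toℕ (punchIn τ k))

  target-injective : Injective _≡_ _≡_ target
  target-injective eq = Fin.punchIn-injective τ _ _ (Fin.toℕ-injective (suc-injective eq))

  target-good : ∀ k → 1 ≤ target k × target k ≤ suc n × target k ≢ suc (toℕ τ)
  target-good k = s≤s z≤n , Fin.toℕ<n (punchIn τ k)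
                , λ eq → Fin.punchInᵢ≢i τ k (Fin.toℕ-injective (suc-injective eq))

  target-onto : ∀ k → ∃ λ e → g e ≡ target k
  target-onto k with 1≤x , x≤ , x≢ ← target-good k = onto (target k) 1≤x x≤ x≢

  range : ∀ {x} → (∃ λ k → x ≡ target k) → 1 ≤ x × x ≤ suc n × x ≢ suc (toℕ τ)
  range (k , refl) = target-good k

-- Labellings as lists of pentagons through the label 0

Pentagon : Set
Pentagon = Vec ℕ 4

⟨_,_,_,_⟩ : (a b c d : ℕ) → Pentagon
⟨ a , b , c , d ⟩ = a Vec.∷ b Vec.∷ c Vec.∷ d Vec.∷ Vec.[]

edge : Pentagon → Fin 5 → ℕ
edge P zero                         = Vec.lookup P (# 0)
edge P (suc zero)                   = ∣ Vec.lookup P (# 0) - Vec.lookup P (# 1) ∣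
edge P (suc (suc zero))             = ∣ Vec.lookup P (# 1) - Vec.lookup P (# 2) ∣
edge P (suc (suc (suc zero)))       = ∣ Vec.lookup P (# 2) - Vec.lookup P (# 3) ∣
edge P (suc (suc (suc (suc zero)))) = Vec.lookup P (# 3)

HasVertex HasEdge : ℕ → Pentagon → Set
HasVertex x P = ∃ λ j → Vec.lookup P j ≡ x
HasEdge   x P = ∃ λ j → edge P j ≡ x

-- By counting, covering every label forces both kinds of label to be distinct.
record Covering (p : ℕ) (Q : List Pentagon) (top : ℕ) : Set where
  field
    unused   : List ℕ
    unused#  : length unused ≡ suc p
    top∈     : top ∈ unused
    top≤     : top ≤ suc (p * 5)
    vertices : ∀ x → x ≤ suc (p * 5) → x ≡ 0 ⊎ Any (HasVertex x) Q ⊎ x ∈ unused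
    edges    : ∀ x → 1 ≤ x → x ≤ suc (p * 5) → x ≢ top → Any (HasEdge x) Q

label : (Q : List Pentagon) → C5Vert (length Q) → ℕ
label Q center    = 0
label Q (vtx i j) = Vec.lookup (lookup Q i) j

edgeLabel-combine : ∀ Q i j → edgeLabel (C5^ (length Q)) (label Q) (combine i j) ≡ edge (lookup Q i) j
edgeLabel-combine Q i j = trans (cong pairLabel (Fin.remQuot-combine i j)) (pairLabel≡edge j)
  where
  pairLabel : Fin (length Q) × Fin 5 → ℕ
  pairLabel (i , j) = ∣ label Q (proj₁ (c5Edge i j)) - label Q (proj₂ (c5Edge i j)) ∣

  pairLabel≡edge : ∀ j → pairLabel (i , j) ≡ edge (lookup Q i) j
  pairLabel≡edge zero                         = refl
  pairLabel≡edge (suc zero)                   = refl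
  pairLabel≡edge (suc (suc zero))             = refl
  pairLabel≡edge (suc (suc (suc zero)))       = refl
  pairLabel≡edge (suc (suc (suc (suc zero)))) = ∣-∣-identityʳ _

module _ {Q : List Pentagon} {top : ℕ} (cov : Covering (length Q) Q top) where
  open Covering cov

  private
    p : ℕ
    p = length Q

    Slot : Set
    Slot = Fin 1 ⊎ (Fin p × Fin 4) ⊎ Fin (length unused)

    N : ℕ
    N = 1 + (p * 4 + length unused)

    N≡ : N ≡ 2 + p * 5
    N≡ rewrite unused# = lemma p
      where
      lemma : ∀ n → 1 + (n * 4 + suc n) ≡ 2 + n * 5
      lemma = solve-∀

    slots : Slot ↣ Fin N
    slots = Inverse⇒Injection
      (↔-sym ((↔-id _ ⊎-↔ ((Fin.*↔× ⊎-↔ ↔-id _) ↔-∘ Fin.+↔⊎)) ↔-∘ Fin.+↔⊎))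

    value : Slot → ℕ
    value (inj₁ _)              = 0
    value (inj₂ (inj₁ (i , j))) = Vec.lookup (lookup Q i) j
    value (inj₂ (inj₂ u))       = lookup unused u

    value-onto : ∀ k → ∃ λ s → value s ≡ toℕ {N} k
    value-onto k with vertices (toℕ k) (s≤s⁻¹ (subst (toℕ k <_) N≡ (Fin.toℕ<n k)))
    ... | inj₁ k≡0        = inj₁ zero , sym k≡0
    ... | inj₂ (inj₁ hit) = inj₂ (inj₁ (-, proj₁ (Any.lookup-index hit))) , proj₂ (Any.lookup-index hit)
    ... | inj₂ (inj₂ hit) = inj₂ (inj₂ (Any.index hit)) , sym (Any.lookup-index hit)

    value-injective : Injective _≡_ _≡_ value
    value-injective = covering⇒injective slots {g = value} Fin.toℕ-injective value-onto

    slot : C5Vert p → Slot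
    slot center    = inj₁ zero
    slot (vtx i j) = inj₂ (inj₁ (i , j))

    slot-injective : Injective _≡_ _≡_ slot
    slot-injective {center}  {center}  _    = refl
    slot-injective {vtx _ _} {vtx _ _} refl = refl

    label≡ : ∀ v → label Q v ≡ value (slot v)
    label≡ center    = refl
    label≡ (vtx i j) = refl

    slot-used : ∀ v u → slot v ≢ inj₂ (inj₂ u)
    slot-used center    _ ()
    slot-used (vtx _ _) _ ()

  label-injective : Injective _≡_ _≡_ (label Q)
  label-injective {u} {v} eq =
    slot-injective (value-injective (trans (sym (label≡ u)) (trans eq (label≡ v))))

  label≤ : ∀ v → label Q v ≤ suc (p * 5)
  label≤ v = bound (covering⇒values slots {g = value} Fin.toℕ-injective value-onto (slot v))
    where
    bound : (∃ λ k → value (slot v) ≡ toℕ {N} k) → label Q v ≤ suc (p * 5)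
    bound (k , eq) = s≤s⁻¹ (subst₂ _<_ (sym (trans (label≡ v) eq)) N≡ (Fin.toℕ<n k))

  label≢top : ∀ v → label Q v ≢ top
  label≢top v eq = slot-used v (Any.index top∈)
    (value-injective (trans (sym (label≡ v)) (trans eq (Any.lookup-index top∈))))

  edgeLabel-bijOnto : BijOnto (edgeLabel (C5^ p) (label Q)) (λ x → 1 ≤ x × x ≤ suc (p * 5) × x ≢ top)
  edgeLabel-bijOnto = covering⇒bijOnto (edgeLabel (C5^ p) (label Q)) (label≢top center ∘ sym) top≤
    λ x 1≤x x≤ x≢ → locate (edges x 1≤x x≤ x≢)
    where
    locate : ∀ {x} → Any (HasEdge x) Q → ∃ λ e → edgeLabel (C5^ p) (label Q) e ≡ x
    locate hit = combine (Any.index hit) (proj₁ (Any.lookup-index hit))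
               , trans (edgeLabel-combine Q (Any.index hit) _) (proj₂ (Any.lookup-index hit))

BijOnto-⇔ : ∀ {k} {g : Fin k → ℕ} {A B : ℕ → Set} →
            (∀ {x} → A x → B x) → (∀ {x} → B x → A x) → BijOnto g A → BijOnto g B
BijOnto-⇔ to from (inj , range , onto) = inj , to ∘ range , λ x → onto x ∘ from

-- Here `top` is m+1: the vertices avoid it, so their labels are at most m, and the edge labels are
-- 1, ..., m.
covering⇒graceful : ∀ {p Q} → length Q ≡ p → Covering p Q (suc (p * 5)) → Graceful (C5^ p)
covering⇒graceful {Q = Q} refl cov = label Q , label-injective cov
  , (λ v → s≤s⁻¹ (≤∧≢⇒< (label≤ cov v) (label≢top cov v)))
  , BijOnto-⇔ (λ { (1≤x , x≤ , x≢) → 1≤x , s≤s⁻¹ (≤∧≢⇒< x≤ x≢) })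
              (λ { (1≤x , x≤) → 1≤x , m≤n⇒m≤1+n x≤ , <⇒≢ (s≤s x≤) })
              (edgeLabel-bijOnto cov)

-- Here `top` is m, which leaves 1, ..., m-1, m+1 for the edges: the second of the two sets allowed.
covering⇒nearGraceful : ∀ {p Q} → length Q ≡ p → Covering p Q (p * 5) → NearGraceful (C5^ p)
covering⇒nearGraceful {Q = Q} refl cov = label Q , label-injective cov , label≤ cov
  , inj₂ (BijOnto-⇔ to from (edgeLabel-bijOnto cov))
  where
  m′ : ℕ
  m′ = length Q * 5
  to : ∀ {x} → 1 ≤ x × x ≤ suc m′ × x ≢ m′ → SetA₂ m′ x
  to {x} (1≤x , x≤ , x≢) with x ≟ suc m′
  ... | yes x≡ = inj₂ x≡
  ... | no x≢suc = inj₁ (1≤x , ≤∧≢⇒< (s≤s⁻¹ (≤∧≢⇒< x≤ x≢suc)) x≢)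
  from : ∀ {x} → SetA₂ m′ x → 1 ≤ x × x ≤ suc m′ × x ≢ m′
  from (inj₁ (1≤x , x<)) = 1≤x , m≤n⇒m≤1+n (<⇒≤ x<) , <⇒≢ x<
  from (inj₂ refl)       = s≤s z≤n , ≤-refl , 1+n≢n

-- Tilings by progressions whose ends are linear in a parameter

infix  9 _·t+_
infixl 6 _⊕_
infixl 7 _⊗_

-- Affine functions of `t` are kept as coefficients, so that an identity valid for all `t` is
-- checked by comparing numerals.
record Lin : Set where
  constructor _·t+_
  field slope const : ℕ

⟦_⟧ : Lin → ℕ → ℕ
⟦ c ·t+ k ⟧ t = k + c * t

_⊕_ : Lin → Lin → Lin
(c ·t+ k) ⊕ (c′ ·t+ k′) = (c + c′) ·t+ (k + k′)

_⊗_ : ℕ → Lin → Lin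
m ⊗ (c ·t+ k) = (m * c) ·t+ (m * k)

1⊕_ : Lin → Lin
1⊕ (c ·t+ k) = c ·t+ suc k

⟦⊕⟧ : ∀ l l′ t → ⟦ l ⊕ l′ ⟧ t ≡ ⟦ l ⟧ t + ⟦ l′ ⟧ t
⟦⊕⟧ (c ·t+ k) (c′ ·t+ k′) t = lemma c k c′ k′ t
  where
  lemma : ∀ c k c′ k′ t → k + k′ + (c + c′) * t ≡ k + c * t + (k′ + c′ * t)
  lemma = solve-∀

⟦⊗⟧ : ∀ m l t → ⟦ m ⊗ l ⟧ t ≡ m * ⟦ l ⟧ t
⟦⊗⟧ m (c ·t+ k) t = lemma m c k t
  where
  lemma : ∀ m c k t → m * k + m * c * t ≡ m * (k + c * t)
  lemma = solve-∀

_≟ᴸ_ : (l l′ : Lin) → Dec (l ≡ l′)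
(c ·t+ k) ≟ᴸ (c′ ·t+ k′) with c ≟ c′ | k ≟ k′
... | yes refl | yes refl = yes refl
... | no c≢    | _        = no λ { refl → c≢ refl }
... | yes _    | no k≢    = no λ { refl → k≢ refl }

-- The progression l, l + σ, …, l + n σ (n + 1 terms), for the step σ in force.
Progression : Set
Progression = Lin × Lin

record Fills (σ t : ℕ) (P : ℕ → Set) (progression : Progression) : Set where
  constructor fills
  field term : ∀ r → r ≤ ⟦ proj₂ progression ⟧ t → P (⟦ proj₁ progression ⟧ t + r * σ)

startingAt : ∀ l (S : List Progression) → Maybe (∃ λ n → (l , n) ∈ S)
startingAt l []             = nothing
startingAt l ((l′ , n) ∷ S) with l ≟ᴸ l′
... | yes refl = just (n , here refl)
... | no _     = Maybe.map (map₂ there) (startingAt l S)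

-- The number of consecutive terms from l that are covered by chaining progressions end to end.
reach : (σ : ℕ) → List Progression → (fuel : ℕ) → Lin → Lin
reach σ S zero       l = 0 ·t+ 0
reach σ S (suc fuel) l with startingAt l S
... | nothing      = 0 ·t+ 0
... | just (n , _) = 1⊕ n ⊕ reach σ S fuel (l ⊕ (σ ⊗ 1⊕ n))

module _ {σ t : ℕ} {S : List Progression} {P : ℕ → Set} (tiles : All (Fills σ t P) S) where

  -- Either the term lies in the first progression, or subtracting the length of that progression
  -- leaves a term of the remaining chain. Running out of fuel only makes `reach` smaller.
  reach-sound : ∀ fuel l r → r < ⟦ reach σ S fuel l ⟧ t → P (⟦ l ⟧ t + r * σ)
  reach-sound (suc fuel) l r r< with startingAt l S
  ... | just (n , hit) with r ≤? ⟦ n ⟧ t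
  ...   | yes r≤ = Fills.term (All.lookup tiles hit) r r≤
  ...   | no r≰ with m≤n⇒∃[o]m+o≡n (≰⇒> r≰)
  ...     | r′ , refl = subst P shift (reach-sound fuel (l ⊕ (σ ⊗ 1⊕ n)) r′
              (+-cancelˡ-< (suc (⟦ n ⟧ t)) r′ _ (subst (suc (⟦ n ⟧ t) + r′ <_) (⟦⊕⟧ (1⊕ n) _ t) r<)))
    where
    shift : ⟦ l ⊕ (σ ⊗ 1⊕ n) ⟧ t + r′ * σ ≡ ⟦ l ⟧ t + (suc (⟦ n ⟧ t) + r′) * σ
    shift rewrite ⟦⊕⟧ l (σ ⊗ 1⊕ n) t | ⟦⊗⟧ σ (1⊕ n) t = lemma (⟦ l ⟧ t) (⟦ n ⟧ t) r′ σ
      where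
      lemma : ∀ x y r σ → x + σ * suc y + r * σ ≡ x + (suc y + r) * σ
      lemma = solve-∀

tile : ∀ {t S} {P : ℕ → Set} → All (Fills 1 t P) S → ∀ fuel l {r} →
       r < ⟦ reach 1 S fuel l ⟧ t → P (⟦ l ⟧ t + r)
tile {t} {P = P} tiles fuel l {r} r< =
  subst (λ x → P (⟦ l ⟧ t + x)) (*-identityʳ r) (reach-sound tiles fuel l r r<)

point : ∀ {t P l} → P (⟦ l ⟧ t) → Fills 1 t P (l , 0 ·t+ 0)
point {P = P} Pl = fills λ { zero _ → subst P (sym (+-identityʳ _)) Pl }

interval : ∀ {t P l n} → (∀ r → r ≤ ⟦ n ⟧ t → P (⟦ l ⟧ t + r)) → Fills 1 t P (l , n)
interval {t} {P} {l} f = fills λ r r≤ → subst (λ x → P (⟦ l ⟧ t + x)) (sym (*-identityʳ r)) (f r r≤)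

-- From Langford-type sequences to pentagons

Pair : Set
Pair = ℕ × ℕ

Meets : ℕ → Pair → Set
Meets x (a , i) = x ≡ a ⊎ x ≡ a + i

Differs : ℕ → Pair → Set
Differs x (a , i) = x ≡ i

reserved : (p w : ℕ) → List ℕ
reserved p w = 1 ∷ suc p ∷ w ∷ suc (p + w) ∷ 2 + p + w ∷ []

-- Here p = n + 3.  Together with the pairs {1, p+1} and {w, w+p+1}, of differences p and p+1,
-- the pairs {a, a+i} have the differences 2, …, p+1 and fill 1, …, 2p+1 except w+p+2.
record Langford (n w : ℕ) (L : List Pair) : Set where
  field
    size        : length L ≡ suc n
    positions   : ∀ {r} → r < 7 + 2 * n → 1 + r ∈ reserved (3 + n) w ⊎ Any (Meets (1 + r)) L
    differences : ∀ {r} → r < suc n → Any (Differs (2 + r)) L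

∣-∣-up : ∀ a {b x} → b ≡ a + x → ∣ a - b ∣ ≡ x
∣-∣-up a {x = x} refl = ∣m-m+n∣≡n a x

∣-∣-down : ∀ b {a x} → a ≡ b + x → ∣ a - b ∣ ≡ x
∣-∣-down b {a} eq = trans (∣-∣-comm a b) (∣-∣-up b eq)

module Construction (n w : ℕ) where

  p : ℕ
  p = 3 + n

  -- Two copies of the positions, shifted by p-1 and by 3p. They are K = 2p+1 apart, so crossing
  -- from one copy to the other between positions a and a+i gives K-i or K+i.
  low high : ℕ → ℕ
  low  x = 2 + n + x
  high x = 3 * p + x

  -- The path a, b, c, d has steps 2p+1-i, i, 2p+1+i: every difference i serves three edges.
  bulk : Pair → Pentagon
  bulk (a , i) = ⟨ high a , low (a + i) , low a , high (a + i) ⟩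

  -- The pairs of differences p and p+1 use up the edges left over by the others.
  first second : Pentagon
  first  = ⟨ high 1 , 2 + n , low (suc p) , high (suc p) ⟩
  second = ⟨ high w , low (suc (p + w)) , low (2 + p + w) , high (suc (p + w)) ⟩

  pentagons : List Pair → List Pentagon
  pentagons L = first ∷ second ∷ map bulk L

  -- The position w+p+2 left free by the sequence gives no neighbour of the centre, so its high
  -- label occurs neither on a vertex nor on an edge.
  top : ℕ
  top = high (2 + p + w)

  -- The two special pentagons use `2 + n`, which is `low 0`, in place of `low 1`, and the low label
  -- of the free position in place of `low w`. The labels 1, ..., p-2 lie below all of these.
  unused : List ℕ
  unused = top ∷ low 1 ∷ low w ∷ map suc (upTo (suc n))

  module _ {L : List Pair} (langford : Langford n w L) where
    open Langford langford

    Q : List Pentagon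
    Q = pentagons L

    Position : ℕ → Set
    Position x = x ∈ reserved p w ⊎ Any (Meets x) L

    VertexLabel EdgeLabel : ℕ → Set
    VertexLabel x = x ≡ 0 ⊎ Any (HasVertex x) Q ⊎ x ∈ unused
    EdgeLabel x = x ≢ top → Any (HasEdge x) Q

    vertex₁ : ∀ {x} → HasVertex x first → VertexLabel x
    vertex₁ = inj₂ ∘ inj₁ ∘ here
    vertex₂ : ∀ {x} → HasVertex x second → VertexLabel x
    vertex₂ = inj₂ ∘ inj₁ ∘ there ∘ here
    inBulk : ∀ {R : Pentagon → Set} → Any (R ∘ bulk) L → Any R Q
    inBulk = there ∘ there ∘ Any.map⁺

    high-vertex : ∀ {x} → Position x → VertexLabel (high x)
    high-vertex (inj₁ (here refl))                          = vertex₁ (# 0 , refl)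
    high-vertex (inj₁ (there (here refl)))                  = vertex₁ (# 3 , refl)
    high-vertex (inj₁ (there (there (here refl))))          = vertex₂ (# 0 , refl)
    high-vertex (inj₁ (there (there (there (here refl)))))  = vertex₂ (# 3 , refl)
    high-vertex (inj₁ (there (there (there (there (here refl)))))) = inj₂ (inj₂ (here refl))
    high-vertex (inj₂ hit) = inj₂ (inj₁ (inBulk (Any.map
      (λ { (inj₁ refl) → # 0 , refl ; (inj₂ refl) → # 3 , refl }) hit)))

    low-vertex : ∀ {x} → Position x → VertexLabel (low x)
    low-vertex (inj₁ (here refl))                          = inj₂ (inj₂ (there (here refl)))
    low-vertex (inj₁ (there (here refl)))                  = vertex₁ (# 2 , refl)
    low-vertex (inj₁ (there (there (here refl))))          = inj₂ (inj₂ (there (there (here refl))))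
    low-vertex (inj₁ (there (there (there (here refl)))))  = vertex₂ (# 1 , refl)
    low-vertex (inj₁ (there (there (there (there (here refl)))))) = vertex₂ (# 2 , refl)
    low-vertex (inj₂ hit) = inj₂ (inj₁ (inBulk (Any.map
      (λ { (inj₁ refl) → # 2 , refl ; (inj₂ refl) → # 1 , refl }) hit)))

    -- The centre has label 0, so an edge at the centre repeats the label of its other end; the
    -- cases are those of `high-vertex`.
    high-edge : ∀ {x} → Position x → EdgeLabel (high x)
    high-edge (inj₁ (here refl))                         _ = here (# 0 , refl)
    high-edge (inj₁ (there (here refl)))                 _ = here (# 4 , refl)
    high-edge (inj₁ (there (there (here refl))))         _ = there (here (# 0 , refl))
    high-edge (inj₁ (there (there (there (here refl))))) _ = there (here (# 4 , refl))
    high-edge (inj₁ (there (there (there (there (here refl)))))) ≢top = contradiction refl ≢top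
    high-edge (inj₂ hit) _ = inBulk (Any.map
      (λ { (inj₁ refl) → # 0 , refl ; (inj₂ refl) → # 4 , refl }) hit)

    bulk-edge : ∀ {i x} j → (∀ a → edge (bulk (a , i)) j ≡ x) → Any (Differs i) L → EdgeLabel x
    bulk-edge j eq hit _ = inBulk (Any.map (λ { {a , _} refl → j , eq a }) hit)

    high≡ : ∀ n r → 3 * (3 + n) + (1 + r) ≡ 10 + 3 * n + r
    high≡ = solve-∀

    -- In terms of p = n+3: 0; 1, ..., p-2; p-1; the low copy p, ..., 3p; the high copy 3p+1, ...,
    -- 5p+1.
    vertex-tiles : List Progression
    vertex-tiles = (0 ·t+ 0 , 0 ·t+ 0) ∷ (0 ·t+ 1 , 1 ·t+ 0) ∷ (1 ·t+ 2 , 0 ·t+ 0)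
                 ∷ (1 ·t+ 3 , 2 ·t+ 6) ∷ (3 ·t+ 10 , 2 ·t+ 6) ∷ []

    vertex-tiling : All (Fills 1 n VertexLabel) vertex-tiles
    vertex-tiling =
            point (inj₁ refl)
      All.∷ interval (λ r r≤ → inj₂ (inj₂ (there (there (there
              (∈-map⁺ suc (∈-upTo⁺ (s≤s (subst (r ≤_) (+-identityʳ n) r≤)))))))))
      All.∷ point (vertex₁ (# 1 , cong (2 +_) (sym (+-identityʳ n))))
      All.∷ interval (λ r r≤ → subst VertexLabel (low≡ n r) (low-vertex (positions (s≤s r≤))))
      All.∷ interval (λ r r≤ → subst VertexLabel (high≡ n r) (high-vertex (positions (s≤s r≤))))
      All.∷ All.[]
      where
      low≡ : ∀ n r → 2 + n + (1 + r) ≡ 3 + 1 * n + r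
      low≡ = solve-∀

    -- With K = 2p+1 and i running over 2, ..., p-1, the blocks are 1; i; p; p+1; K-i; 2p; 2p+1;
    -- 2p+2; K+i; and the edges at the centre 3p+1, ..., 5p+1. The six single labels come from the
    -- two special pentagons.
    edge-tiles : List Progression
    edge-tiles = (0 ·t+ 1 , 0 ·t+ 0) ∷ (0 ·t+ 2 , 1 ·t+ 0) ∷ (1 ·t+ 3 , 0 ·t+ 0) ∷ (1 ·t+ 4 , 0 ·t+ 0)
               ∷ (1 ·t+ 5 , 1 ·t+ 0) ∷ (2 ·t+ 6 , 0 ·t+ 0) ∷ (2 ·t+ 7 , 0 ·t+ 0) ∷ (2 ·t+ 8 , 0 ·t+ 0)
               ∷ (2 ·t+ 9 , 1 ·t+ 0) ∷ (3 ·t+ 10 , 2 ·t+ 6) ∷ []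

    edge-tiling : All (Fills 1 n EdgeLabel) edge-tiles
    edge-tiling =
            point (λ _ → there (here (# 2 , ∣-∣-up (low (suc (p + w))) (s₂ n w))))
      All.∷ interval (λ r r≤ → bulk-edge (# 2) (λ a → ∣-∣-down (low a) (b₂ n a r)) (differences (s≤s (r≤n r≤))))
      All.∷ point (λ _ → there (here (# 1 , ∣-∣-down (low (suc (p + w))) (s₁ n w))))
      All.∷ point (λ _ → here (# 2 , ∣-∣-up (2 + n) (f₂ n)))
      All.∷ interval (λ r r≤ → mirrored (m≤n⇒∃[o]m+o≡n (r≤n r≤)))
      All.∷ point (λ _ → there (here (# 3 , ∣-∣-up (low (2 + p + w)) (s₃ n w))))
      All.∷ point (λ _ → here (# 3 , ∣-∣-up (low (suc p)) (f₃ n)))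
      All.∷ point (λ _ → here (# 1 , ∣-∣-down (2 + n) (f₁ n)))
      All.∷ interval (λ r r≤ → bulk-edge (# 3) (λ a → ∣-∣-up (low a) (b₃ n a r)) (differences (s≤s (r≤n r≤))))
      All.∷ interval (λ r r≤ → subst EdgeLabel (high≡ n r) (high-edge (positions (s≤s r≤))))
      All.∷ All.[]
      where
      f₁ : ∀ n → 3 * (3 + n) + 1 ≡ 2 + n + (8 + 2 * n)
      f₁ = solve-∀
      f₂ : ∀ n → 2 + n + suc (3 + n) ≡ 2 + n + (4 + 1 * n)
      f₂ = solve-∀
      f₃ : ∀ n → 3 * (3 + n) + suc (3 + n) ≡ 2 + n + suc (3 + n) + (7 + 2 * n)
      f₃ = solve-∀
      s₁ : ∀ n w → 3 * (3 + n) + w ≡ 2 + n + suc (3 + n + w) + (3 + 1 * n)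
      s₁ = solve-∀
      s₂ : ∀ n w → 2 + n + (2 + (3 + n) + w) ≡ 2 + n + suc (3 + n + w) + 1
      s₂ = solve-∀
      s₃ : ∀ n w → 3 * (3 + n) + suc (3 + n + w) ≡ 2 + n + (2 + (3 + n) + w) + (6 + 2 * n)
      s₃ = solve-∀
      b₁ : ∀ a r o → 3 * (3 + (r + o)) + a ≡ 2 + (r + o) + (a + (2 + o)) + (5 + 1 * (r + o) + r)
      b₁ = solve-∀
      b₂ : ∀ n a r → 2 + n + (a + (2 + r)) ≡ 2 + n + a + (2 + r)
      b₂ = solve-∀
      b₃ : ∀ n a r → 3 * (3 + n) + (a + (2 + r)) ≡ 2 + n + a + (9 + 2 * n + r)
      b₃ = solve-∀

      r≤n : ∀ {r} → r ≤ 1 * n → r ≤ n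
      r≤n {r} = subst (r ≤_) (+-identityʳ n)

      -- The labels K-i fall as i grows, so p+2+r comes from the difference 2+o with o = n-r.
      mirrored : ∀ {r} → (∃ λ o → r + o ≡ n) → EdgeLabel (5 + 1 * n + r)
      mirrored {r} (o , eq) = bulk-edge (# 1)
        (λ a → ∣-∣-down (low (a + (2 + o))) (subst (λ m → 3 * (3 + m) + a ≡ 2 + m + (a + (2 + o)) + (5 + 1 * m + r)) eq (b₁ a r o)))
        (differences (s≤s (subst (o ≤_) eq (m≤n+m o r))))

    covering : w ≤ 2 + n → Covering p Q top
    covering w≤ = record
      { unused   = unused
      ; unused#  = cong (3 +_) (trans (length-map suc (upTo (suc n))) (length-upTo (suc n)))
      ; top∈     = here refl
      ; top≤     = subst₂ _≤_ refl (top≡ n) (+-monoʳ-≤ (3 * p) (+-monoʳ-≤ (2 + p) w≤))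
      -- The fuels 10 and 20 exceed the numbers of tiles, 5 and 10, and `reach` evaluates to 17+5n
      -- labels from 0 and to 16+5n labels from 1.
      ; vertices = λ x x≤ → tile vertex-tiling 10 (0 ·t+ 0) (s≤s (subst (x ≤_) (m≡ n) x≤))
      ; edges    = λ { (suc x) _ x< → tile edge-tiling 20 (0 ·t+ 1) (subst (x <_) (m≡ n) x<) }
      }
      where
      m≡ : ∀ n → suc ((3 + n) * 5) ≡ 16 + 5 * n
      m≡ = solve-∀
      top≡ : ∀ n → 3 * (3 + n) + (2 + (3 + n) + (2 + n)) ≡ suc ((3 + n) * 5)
      top≡ = solve-∀

    size-pentagons : length Q ≡ p
    size-pentagons = cong (2 +_) (trans (length-map bulk L) size)

-- Families of nested pairs

-- The pairs {a+n, a+n+δ}, {a+n-1, a+n+δ+1}, …, {a, a+2n+δ}.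
nest : (a δ n : ℕ) → List Pair
nest a δ zero    = (a , δ) ∷ []
nest a δ (suc n) = (a + suc n , δ) ∷ nest a (2 + δ) n

nest-size : ∀ a δ n → length (nest a δ n) ≡ suc n
nest-size a δ zero    = refl
nest-size a δ (suc n) = cong suc (nest-size a (2 + δ) n)

-- The head of the list is the innermost pair, with the largest left end and the smallest right end;
-- hence the induction peels off r = n here and r = 0 in `nest-right`.
nest-left : ∀ a δ n r → r ≤ n → Any (Meets (a + r)) (nest a δ n)
nest-left a δ zero    zero _   = here (inj₁ (+-identityʳ a))
nest-left a δ (suc n) r    r≤ with m≤n⇒m<n∨m≡n r≤
... | inj₁ r<   = there (nest-left a (2 + δ) n r (s≤s⁻¹ r<))
... | inj₂ refl = here (inj₁ refl)

nest-right : ∀ a δ n r → r ≤ n → Any (Meets (a + δ + n + r)) (nest a δ n)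
nest-right a δ zero    zero    _        = here (inj₂ (lemma a δ))
  where
  lemma : ∀ a δ → a + δ + 0 + 0 ≡ a + δ
  lemma = solve-∀
nest-right a δ (suc n) zero    _        = here (inj₂ (lemma a δ n))
  where
  lemma : ∀ a δ n → a + δ + suc n + 0 ≡ a + suc n + δ
  lemma = solve-∀
nest-right a δ (suc n) (suc r) (s≤s r≤) =
  there (subst (λ x → Any (Meets x) (nest a (2 + δ) n)) (lemma a δ n r) (nest-right a (2 + δ) n r r≤))
  where
  lemma : ∀ a δ n r → a + (2 + δ) + n + r ≡ a + δ + suc n + suc r
  lemma = solve-∀

nest-difference : ∀ a δ n r → r ≤ n → Any (Differs (δ + r * 2)) (nest a δ n)
nest-difference a δ zero    zero    _        = here (+-identityʳ δ)
nest-difference a δ (suc n) zero    _        = here (+-identityʳ δ)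
nest-difference a δ (suc n) (suc r) (s≤s r≤) =
  there (subst (λ x → Any (Differs x) (nest a (2 + δ) n)) (lemma δ r) (nest-difference a (2 + δ) n r r≤))
  where
  lemma : ∀ δ r → 2 + δ + r * 2 ≡ δ + suc r * 2
  lemma = solve-∀

-- Dropping index 0 and shifting by one exchanges the even and the odd indices, and the two balance
-- hypotheses change places with them.
interleave : ∀ {D : ℕ → Set} e o → o ≤ e → e ≤ suc o →
             (∀ j → j < e → D (j * 2)) → (∀ j → j < o → D (suc (j * 2))) →
             ∀ r → r < e + o → D r
interleave zero    zero    _   _        _     _    _       ()
interleave (suc e) o       _   _        evens _    zero    _        = evens 0 (s≤s z≤n)
interleave {D} (suc e) o   o≤e (s≤s e≤o) evens odds (suc r) (s≤s r<) =
  interleave {D ∘ suc} o e e≤o o≤e odds (λ j j< → evens (suc j) (s≤s j<)) r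
    (subst (r <_) (+-comm e o) r<)

Piece : Set
Piece = Lin × Lin × Lin

nestAt : ℕ → Piece → List Pair
nestAt t (a , δ , k) = nest (⟦ a ⟧ t) (⟦ δ ⟧ t) (⟦ k ⟧ t)

-- With p = n + 3 as in Langford, and w = n + h.
record Family : Set where
  constructor family
  field
    h      : ℕ
    n      : Lin
    pieces : List Piece

  w : Lin
  w = (0 ·t+ h) ⊕ n

  pairs : ℕ → List Pair
  pairs t = concatMap (nestAt t) pieces

  lefts rights differenceTiles positionTiles : List Progression
  lefts           = map (λ { (a , δ , k) → a , k }) pieces
  rights          = map (λ { (a , δ , k) → a ⊕ δ ⊕ k , k }) pieces
  differenceTiles = map (λ { (a , δ , k) → δ , k }) pieces
  positionTiles   = map (_, 0 ·t+ 0)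
    (0 ·t+ 1 ∷ (0 ·t+ 4) ⊕ n ∷ w ∷ (0 ·t+ 4) ⊕ (n ⊕ w) ∷ (0 ·t+ 5) ⊕ (n ⊕ w) ∷ [])
    ++ lefts ++ rights

  total : List Piece → Lin
  total = foldr (λ { (a , δ , k) l → 1⊕ k ⊕ l }) (0 ·t+ 0)

  -- Differences inside a nest grow by 2, so the nests are chained separately from the differences 2
  -- and 3.
  evens odds : Lin
  evens = reach 2 differenceTiles 50 (0 ·t+ 2)
  odds  = reach 2 differenceTiles 50 (0 ·t+ 3)

-- Every condition compares linear forms, so one evaluation settles all `t`. `balanced` ensures that
-- the even and the odd differences interleave to an unbroken run.
record Valid (F : Family) : Set where
  constructor valid
  open Family F
  field
    size        : total pieces ≡ 1⊕ n
    positions   : reach 1 positionTiles 50 (0 ·t+ 1) ≡ (0 ·t+ 7) ⊕ (2 ⊗ n)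
    differences : evens ⊕ odds ≡ 1⊕ n
    balanced    : evens ≡ odds ⊎ evens ≡ 1⊕ odds

module _ {F : Family} (F-valid : Valid F) (t : ℕ) where
  open Family F
  private module V = Valid F-valid

  size-pairs : ∀ ps → length (concatMap (nestAt t) ps) ≡ ⟦ total ps ⟧ t
  size-pairs [] = refl
  size-pairs (q@(a , δ , k) ∷ ps) = trans (length-++ (nestAt t q))
    (trans (cong₂ _+_ (nest-size (⟦ a ⟧ t) (⟦ δ ⟧ t) (⟦ k ⟧ t)) (size-pairs ps))
           (sym (⟦⊕⟧ (1⊕ k) (total ps) t)))

  inPairs : ∀ {R : Pair → Set} {q} → q ∈ pieces → Any R (nestAt t q) → Any R (pairs t)
  inPairs q∈ hit = Any.concatMap⁺ (nestAt t) (lose q∈ hit)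

  Position Difference : ℕ → Set
  Position   x = x ∈ reserved (3 + ⟦ n ⟧ t) (⟦ w ⟧ t) ⊎ Any (Meets x) (pairs t)
  Difference x = Any (Differs x) (pairs t)

  overPieces : ∀ {σ P} (f : Piece → Progression) → (∀ {q} → q ∈ pieces → Fills σ t P (f q)) →
               All (Fills σ t P) (map f pieces)
  overPieces f fill = All.map⁺ (All.tabulate fill)

  n+w : ∀ k → ⟦ (0 ·t+ k) ⊕ (n ⊕ w) ⟧ t ≡ k + (⟦ n ⟧ t + ⟦ w ⟧ t)
  n+w k = trans (⟦⊕⟧ (0 ·t+ k) (n ⊕ w) t) (cong₂ _+_ (+-identityʳ k) (⟦⊕⟧ n w t))

  position-tiling : All (Fills 1 t Position) positionTiles
  position-tiling = All.++⁺
    (     point (inj₁ (here refl))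
    All.∷ point (inj₁ (there (here refl)))
    All.∷ point (inj₁ (there (there (here refl))))
    All.∷ point (inj₁ (there (there (there (here (n+w 4))))))
    All.∷ point (inj₁ (there (there (there (there (here (n+w 5)))))))
    All.∷ All.[])
    (All.++⁺
      (overPieces _ λ { {a , δ , k} q∈ → interval λ r r≤ →
        inj₂ (inPairs q∈ (nest-left (⟦ a ⟧ t) (⟦ δ ⟧ t) (⟦ k ⟧ t) r r≤)) })
      (overPieces _ λ { {a , δ , k} q∈ → interval λ r r≤ →
        subst (λ x → Position (x + r)) (sym (trans (⟦⊕⟧ (a ⊕ δ) k t) (cong (_+ ⟦ k ⟧ t) (⟦⊕⟧ a δ t))))
          (inj₂ (inPairs q∈ (nest-right (⟦ a ⟧ t) (⟦ δ ⟧ t) (⟦ k ⟧ t) r r≤))) }))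

  difference-tiling : All (Fills 2 t Difference) differenceTiles
  difference-tiling = overPieces _ λ { {a , δ , k} q∈ → fills λ r r≤ →
    inPairs q∈ (nest-difference (⟦ a ⟧ t) (⟦ δ ⟧ t) (⟦ k ⟧ t) r r≤) }

  e o : ℕ
  e = ⟦ evens ⟧ t
  o = ⟦ odds ⟧ t

  at-t : ∀ {l l′} → l ≡ l′ → ⟦ l ⟧ t ≡ ⟦ l′ ⟧ t
  at-t = cong (λ l → ⟦ l ⟧ t)

  balance : o ≤ e × e ≤ suc o
  balance = [ (λ eq → ≤-reflexive (at-t (sym eq)) , m≤n⇒m≤1+n (≤-reflexive (at-t eq)))
            , (λ eq → <⇒≤ (≤-reflexive (at-t (sym eq))) , ≤-reflexive (at-t eq))
            ]′ V.balanced

  valid⇒langford : Langford (⟦ n ⟧ t) (⟦ w ⟧ t) (pairs t)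
  valid⇒langford = record
    { size        = trans (size-pairs pieces) (at-t V.size)
    ; positions   = λ {r} r< → tile position-tiling 50 (0 ·t+ 1)
        (subst (r <_) (sym (trans (at-t V.positions)
                                  (trans (⟦⊕⟧ (0 ·t+ 7) (2 ⊗ n) t) (cong (7 +_) (⟦⊗⟧ 2 n t))))) r<)
    ; differences = λ {r} r< → interleave {λ x → Difference (2 + x)} e o (proj₁ balance) (proj₂ balance)
        (reach-sound difference-tiling 50 (0 ·t+ 2)) (reach-sound difference-tiling 50 (0 ·t+ 3)) r
        (subst (r <_) (trans (at-t (sym V.differences)) (⟦⊕⟧ evens odds t)) r<)
    }

-- For w = p-1 the free position is 2p+1, so `top` is 3p + (2p+1) = m+1.
langford⇒graceful : ∀ {n L} → Langford n (2 + n) L → Graceful (C5^ (3 + n))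
langford⇒graceful {n} {L} langford = covering⇒graceful (size-pentagons langford)
  (subst (Covering p (pentagons L)) (lemma n) (covering langford ≤-refl))
  where
  open Construction n (2 + n)
  lemma : ∀ n → 3 * (3 + n) + (2 + (3 + n) + (2 + n)) ≡ suc ((3 + n) * 5)
  lemma = solve-∀

-- For w = p-2 the free position is 2p, the hook, so `top` is 5p = m.
langford⇒nearGraceful : ∀ {n L} → Langford n (1 + n) L → NearGraceful (C5^ (3 + n))
langford⇒nearGraceful {n} {L} langford = covering⇒nearGraceful (size-pentagons langford)
  (subst (Covering p (pentagons L)) (lemma n) (covering langford (n≤1+n _)))
  where
  open Construction n (1 + n)
  lemma : ∀ n → 3 * (3 + n) + (2 + (3 + n) + (1 + n)) ≡ (3 + n) * 5
  lemma = solve-∀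

-- The four residue classes

-- The pieces were found by computer search; p = 20 + ρ + 4t in familyρ.
family0 : Family
family0 = family 2 (4 ·t+ 17)
  ((4 ·t+ 22 , 0 ·t+ 6 , 2 ·t+ 4) ∷ (1 ·t+ 10 , 0 ·t+ 5 , 1 ·t+ 0) ∷
   (0 ·t+ 2 , 2 ·t+ 13 , 1 ·t+ 1) ∷ (1 ·t+ 4 , 0 ·t+ 2 , 0 ·t+ 1) ∷ (1 ·t+ 6 , 0 ·t+ 3 , 0 ·t+ 0) ∷
   (2 ·t+ 11 , 2 ·t+ 7 , 0 ·t+ 0) ∷ (6 ·t+ 27 , 2 ·t+ 9 , 0 ·t+ 1) ∷
   (2 ·t+ 13 , 4 ·t+ 16 , 0 ·t+ 1) ∷ (2 ·t+ 12 , 4 ·t+ 17 , 0 ·t+ 0) ∷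
   (4 ·t+ 20 , 4 ·t+ 19 , 0 ·t+ 0) ∷ [])

family0-valid : Valid family0
family0-valid = valid refl refl refl (inj₁ refl)

family1 : Family
family1 = family 1 (4 ·t+ 18)
  ((1 ·t+ 3 , 0 ·t+ 2 , 1 ·t+ 5) ∷ (5 ·t+ 26 , 0 ·t+ 5 , 1 ·t+ 1) ∷
   (4 ·t+ 23 , 2 ·t+ 13 , 1 ·t+ 2) ∷ (0 ·t+ 2 , 2 ·t+ 16 , 1 ·t+ 0) ∷
   (7 ·t+ 34 , 0 ·t+ 3 , 0 ·t+ 0) ∷ (4 ·t+ 20 , 2 ·t+ 9 , 0 ·t+ 1) ∷
   (6 ·t+ 29 , 2 ·t+ 14 , 0 ·t+ 0) ∷ (3 ·t+ 16 , 4 ·t+ 18 , 0 ·t+ 1) ∷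
   (2 ·t+ 9 , 4 ·t+ 19 , 0 ·t+ 0) ∷ [])

family1-valid : Valid family1
family1-valid = valid refl refl refl (inj₂ refl)

family2 : Family
family2 = family 1 (4 ·t+ 19)
  ((4 ·t+ 24 , 0 ·t+ 6 , 2 ·t+ 6) ∷ (1 ·t+ 11 , 0 ·t+ 5 , 1 ·t+ 0) ∷
   (0 ·t+ 2 , 2 ·t+ 13 , 1 ·t+ 2) ∷ (1 ·t+ 6 , 0 ·t+ 2 , 0 ·t+ 1) ∷ (1 ·t+ 5 , 0 ·t+ 3 , 0 ·t+ 0) ∷
   (2 ·t+ 14 , 2 ·t+ 7 , 0 ·t+ 0) ∷ (4 ·t+ 22 , 2 ·t+ 9 , 0 ·t+ 0) ∷
   (6 ·t+ 34 , 2 ·t+ 11 , 0 ·t+ 0) ∷ (2 ·t+ 12 , 4 ·t+ 19 , 0 ·t+ 1) ∷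
   (2 ·t+ 15 , 4 ·t+ 20 , 0 ·t+ 0) ∷ [])

family2-valid : Valid family2
family2-valid = valid refl refl refl (inj₁ refl)

family3 : Family
family3 = family 2 (4 ·t+ 20)
  ((1 ·t+ 6 , 0 ·t+ 2 , 1 ·t+ 4) ∷ (5 ·t+ 27 , 0 ·t+ 5 , 1 ·t+ 2) ∷ (0 ·t+ 3 , 2 ·t+ 14 , 1 ·t+ 2) ∷
   (4 ·t+ 25 , 2 ·t+ 15 , 1 ·t+ 1) ∷ (7 ·t+ 37 , 0 ·t+ 3 , 0 ·t+ 0) ∷
   (6 ·t+ 31 , 2 ·t+ 11 , 0 ·t+ 1) ∷ (6 ·t+ 33 , 2 ·t+ 12 , 0 ·t+ 0) ∷
   (2 ·t+ 11 , 4 ·t+ 19 , 0 ·t+ 0) ∷ (3 ·t+ 17 , 4 ·t+ 20 , 0 ·t+ 1) ∷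
   (0 ·t+ 2 , 4 ·t+ 21 , 0 ·t+ 0) ∷ [])

family3-valid : Valid family3
family3-valid = valid refl refl refl (inj₂ refl)

-- Small cases

singles : List Pair → List Piece
singles = map λ { (a , i) → 0 ·t+ a , 0 ·t+ i , 0 ·t+ 0 }

-- A single sequence is a family constant in `t`, each pair being a nest of one, so the check by
-- `Valid` applies to it as well.
sporadic : (h n : ℕ) → List Pair → Family
sporadic h n L = family h (0 ·t+ n) (singles L)

hasVertex? : ∀ x P → Dec (HasVertex x P)
hasVertex? x P = Fin.any? λ j → Vec.lookup P j ≟ x

hasEdge? : ∀ x P → Dec (HasEdge x P)
hasEdge? x P = Fin.any? λ j → edge P j ≟ x

module _ (p : ℕ) (Q : List Pentagon) (top : ℕ) where

  rest : List ℕ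
  rest = filter (λ x → ¬? (x ≟ 0) ×-dec ¬? (Any.any? (hasVertex? x) Q)) (upTo (2 + p * 5))

  vertices? : Dec (∀ {x} → x < 2 + p * 5 → x ≡ 0 ⊎ Any (HasVertex x) Q ⊎ x ∈ rest)
  vertices? = allUpTo? (λ x → (x ≟ 0) ⊎-dec Any.any? (hasVertex? x) Q ⊎-dec (x ∈? rest)) (2 + p * 5)

  edges? : Dec (∀ {x} → x < 2 + p * 5 → 1 ≤ x → x ≢ top → Any (HasEdge x) Q)
  edges? = allUpTo? (λ x → (1 ≤? x) →-dec (¬? (x ≟ top) →-dec Any.any? (hasEdge? x) Q)) (2 + p * 5)

  computed : length rest ≡ suc p → True (top ∈? rest) → True (top ≤? suc (p * 5)) →
             True vertices? → True edges? → Covering p Q top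
  computed size top∈ top≤ vs es = record
    { unused   = rest
    ; unused#  = size
    ; top∈     = toWitness top∈
    ; top≤     = toWitness top≤
    ; vertices = λ x x≤ → toWitness vs (s≤s x≤)
    ; edges    = λ x 1≤x x≤ → toWitness es (s≤s x≤) 1≤x
    }

Claim : ℕ → Set
Claim p = ((p % 4 ≡ 1 ⊎ p % 4 ≡ 2) → NearGraceful (C5^ p)) ×
          ((p % 4 ≡ 0 ⊎ p % 4 ≡ 3) → Graceful (C5^ p))

residues-disjoint : ∀ {r} → r ≡ 1 ⊎ r ≡ 2 → r ≡ 0 ⊎ r ≡ 3 → ⊥
residues-disjoint (inj₁ refl) (inj₁ ())
residues-disjoint (inj₁ refl) (inj₂ ())
residues-disjoint (inj₂ refl) (inj₁ ())
residues-disjoint (inj₂ refl) (inj₂ ())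

-- The residue excludes the hypothesis of the other half, which holds vacuously.
claim-near : ∀ {p} → p % 4 ≡ 1 ⊎ p % 4 ≡ 2 → NearGraceful (C5^ p) → Claim p
claim-near residue near = (λ _ → near) , λ other → ⊥-elim (residues-disjoint residue other)

claim-graceful : ∀ {p} → p % 4 ≡ 0 ⊎ p % 4 ≡ 3 → Graceful (C5^ p) → Claim p
claim-graceful residue graceful = (λ other → ⊥-elim (residues-disjoint other residue)) , λ _ → graceful

near-sporadic : ∀ n L → Valid (sporadic 1 n L) → NearGraceful (C5^ (3 + n))
near-sporadic n L v = subst (λ m → NearGraceful (C5^ (3 + m))) (+-identityʳ n)
  (langford⇒nearGraceful (valid⇒langford v 0))

graceful-sporadic : ∀ n L → Valid (sporadic 2 n L) → Graceful (C5^ (3 + n))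
graceful-sporadic n L v = subst (λ m → Graceful (C5^ (3 + m))) (+-identityʳ n)
  (langford⇒graceful (valid⇒langford v 0))

C5^1 : NearGraceful (C5^ 1)
C5^1 = covering⇒nearGraceful refl (computed 1
  (⟨ 6 , 2 , 1 , 3 ⟩ ∷ [])
  5 refl _ _ _ _)

C5^2 : NearGraceful (C5^ 2)
C5^2 = covering⇒nearGraceful refl (computed 2
  (⟨ 11 , 5 , 2 , 7 ⟩ ∷ ⟨ 9 , 1 , 3 , 4 ⟩ ∷ [])
  10 refl _ _ _ _)

C5^3 : Graceful (C5^ 3)
C5^3 = graceful-sporadic 0
  ((3 , 2) ∷ [])
  (valid refl refl refl (inj₂ refl))

C5^4 : Graceful (C5^ 4)
C5^4 = covering⇒graceful refl (computed 4
  (⟨ 20 , 17 , 1 , 6 ⟩ ∷ ⟨ 19 , 2 , 9 , 11 ⟩ ∷ ⟨ 18 , 4 , 3 , 15 ⟩ ∷ ⟨ 13 , 5 , 14 , 10 ⟩ ∷ [])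
  21 refl _ _ _ _)

C5^5 : NearGraceful (C5^ 5)
C5^5 = near-sporadic 2
  ((2 , 2) ∷ (5 , 3) ∷ (7 , 4) ∷ [])
  (valid refl refl refl (inj₂ refl))

C5^6 : NearGraceful (C5^ 6)
C5^6 = covering⇒nearGraceful refl (computed 6
  (⟨ 31 , 23 , 1 , 18 ⟩ ∷ ⟨ 29 , 22 , 2 , 13 ⟩ ∷ ⟨ 28 , 4 , 5 , 10 ⟩ ∷ ⟨ 27 , 6 , 21 , 19 ⟩ ∷
   ⟨ 26 , 3 , 9 , 12 ⟩ ∷ ⟨ 25 , 11 , 7 , 16 ⟩ ∷ [])
  30 refl _ _ _ _)

C5^7 : Graceful (C5^ 7)
C5^7 = covering⇒graceful refl (computed 7
  (⟨ 35 , 3 , 1 , 18 ⟩ ∷ ⟨ 34 , 22 , 2 , 26 ⟩ ∷ ⟨ 33 , 14 , 4 , 27 ⟩ ∷ ⟨ 31 , 20 , 5 , 9 ⟩ ∷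
   ⟨ 30 , 16 , 8 , 29 ⟩ ∷ ⟨ 28 , 23 , 7 , 6 ⟩ ∷ ⟨ 25 , 32 , 10 , 13 ⟩ ∷ [])
  36 refl _ _ _ _)

C5^8 : Graceful (C5^ 8)
C5^8 = graceful-sporadic 5
  ((2 , 2) ∷ (12 , 3) ∷ (10 , 4) ∷ (3 , 5) ∷ (5 , 6) ∷ (6 , 7) ∷ [])
  (valid refl refl refl (inj₁ refl))

C5^9 : NearGraceful (C5^ 9)
C5^9 = near-sporadic 6
  ((2 , 2) ∷ (3 , 3) ∷ (11 , 4) ∷ (9 , 5) ∷ (13 , 6) ∷ (5 , 7) ∷ (8 , 8) ∷ [])
  (valid refl refl refl (inj₂ refl))

C5^10 : NearGraceful (C5^ 10)
C5^10 = near-sporadic 7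
  ((2 , 2) ∷ (3 , 3) ∷ (13 , 4) ∷ (7 , 5) ∷ (15 , 6) ∷ (9 , 7) ∷ (10 , 8) ∷ (5 , 9) ∷ [])
  (valid refl refl refl (inj₁ refl))

C5^11 : Graceful (C5^ 11)
C5^11 = graceful-sporadic 8
  ((2 , 2) ∷ (17 , 3) ∷ (3 , 4) ∷ (16 , 5) ∷ (9 , 6) ∷ (6 , 7) ∷ (11 , 8) ∷ (5 , 9) ∷ (8 , 10) ∷ [])
  (valid refl refl refl (inj₂ refl))

C5^12 : Graceful (C5^ 12)
C5^12 = graceful-sporadic 9
  ((2 , 2) ∷ (19 , 3) ∷ (6 , 4) ∷ (3 , 5) ∷ (14 , 6) ∷ (16 , 7) ∷ (9 , 8) ∷ (12 , 9) ∷ (5 , 10) ∷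
   (7 , 11) ∷ [])
  (valid refl refl refl (inj₁ refl))

C5^13 : NearGraceful (C5^ 13)
C5^13 = near-sporadic 10
  ((2 , 2) ∷ (3 , 3) ∷ (19 , 4) ∷ (7 , 5) ∷ (9 , 6) ∷ (20 , 7) ∷ (16 , 8) ∷ (13 , 9) ∷ (8 , 10) ∷
   (10 , 11) ∷ (5 , 12) ∷ [])
  (valid refl refl refl (inj₂ refl))

C5^14 : NearGraceful (C5^ 14)
C5^14 = near-sporadic 11
  ((2 , 2) ∷ (3 , 3) ∷ (7 , 4) ∷ (24 , 5) ∷ (20 , 6) ∷ (14 , 7) ∷ (9 , 8) ∷ (16 , 9) ∷ (13 , 10) ∷
   (8 , 11) ∷ (10 , 12) ∷ (5 , 13) ∷ [])
  (valid refl refl refl (inj₁ refl))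

C5^15 : Graceful (C5^ 15)
C5^15 = graceful-sporadic 12
  ((2 , 2) ∷ (25 , 3) ∷ (6 , 4) ∷ (22 , 5) ∷ (23 , 6) ∷ (17 , 7) ∷ (7 , 8) ∷ (11 , 9) ∷ (3 , 10) ∷
   (8 , 11) ∷ (9 , 12) ∷ (5 , 13) ∷ (12 , 14) ∷ [])
  (valid refl refl refl (inj₂ refl))

C5^16 : Graceful (C5^ 16)
C5^16 = graceful-sporadic 13
  ((2 , 2) ∷ (27 , 3) ∷ (6 , 4) ∷ (23 , 5) ∷ (25 , 6) ∷ (7 , 7) ∷ (18 , 8) ∷ (12 , 9) ∷ (3 , 10) ∷
   (11 , 11) ∷ (8 , 12) ∷ (16 , 13) ∷ (5 , 14) ∷ (9 , 15) ∷ [])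
  (valid refl refl refl (inj₁ refl))

C5^17 : NearGraceful (C5^ 17)
C5^17 = near-sporadic 14
  ((2 , 2) ∷ (3 , 3) ∷ (9 , 4) ∷ (7 , 5) ∷ (24 , 6) ∷ (28 , 7) ∷ (23 , 8) ∷ (10 , 9) ∷ (17 , 10) ∷
   (14 , 11) ∷ (20 , 12) ∷ (16 , 13) ∷ (8 , 14) ∷ (11 , 15) ∷ (5 , 16) ∷ [])
  (valid refl refl refl (inj₂ refl))

C5^18 : NearGraceful (C5^ 18)
C5^18 = near-sporadic 15
  ((2 , 2) ∷ (3 , 3) ∷ (9 , 4) ∷ (7 , 5) ∷ (26 , 6) ∷ (10 , 7) ∷ (29 , 8) ∷ (24 , 9) ∷ (18 , 10) ∷
   (20 , 11) ∷ (15 , 12) ∷ (21 , 13) ∷ (11 , 14) ∷ (8 , 15) ∷ (14 , 16) ∷ (5 , 17) ∷ [])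
  (valid refl refl refl (inj₁ refl))

C5^19 : Graceful (C5^ 19)
C5^19 = graceful-sporadic 16
  ((2 , 2) ∷ (33 , 3) ∷ (6 , 4) ∷ (29 , 5) ∷ (11 , 6) ∷ (9 , 7) ∷ (27 , 8) ∷ (21 , 9) ∷ (3 , 10) ∷
   (26 , 11) ∷ (12 , 12) ∷ (19 , 13) ∷ (14 , 14) ∷ (8 , 15) ∷ (15 , 16) ∷ (5 , 17) ∷ (7 , 18) ∷ [])
  (valid refl refl refl (inj₂ refl))

small : All Claim (applyUpTo suc 19)
small =
        claim-near (inj₁ refl) C5^1
  All.∷ claim-near (inj₂ refl) C5^2
  All.∷ claim-graceful (inj₂ refl) C5^3
  All.∷ claim-graceful (inj₁ refl) C5^4
  All.∷ claim-near (inj₁ refl) C5^5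
  All.∷ claim-near (inj₂ refl) C5^6
  All.∷ claim-graceful (inj₂ refl) C5^7
  All.∷ claim-graceful (inj₁ refl) C5^8
  All.∷ claim-near (inj₁ refl) C5^9
  All.∷ claim-near (inj₂ refl) C5^10
  All.∷ claim-graceful (inj₂ refl) C5^11
  All.∷ claim-graceful (inj₁ refl) C5^12
  All.∷ claim-near (inj₁ refl) C5^13
  All.∷ claim-near (inj₂ refl) C5^14
  All.∷ claim-graceful (inj₂ refl) C5^15
  All.∷ claim-graceful (inj₁ refl) C5^16
  All.∷ claim-near (inj₁ refl) C5^17
  All.∷ claim-near (inj₂ refl) C5^18
  All.∷ claim-graceful (inj₂ refl) C5^19
  All.∷ All.[]

-- The range p ≥ 20 and the final case split

[20+r+4t]%4 : ∀ r t → (20 + (r + 4 * t)) % 4 ≡ r % 4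
[20+r+4t]%4 r t = trans (cong (_% 4) (lemma r t)) ([m+kn]%n≡m%n r (5 + t) 4)
  where
  lemma : ∀ r t → 20 + (r + 4 * t) ≡ r + (5 + t) * 4
  lemma = solve-∀

-- The family's `w` evaluates to 2+n at n = 17+4t, and 3+n to 20+4t, so the types match by
-- computation; likewise in the next three.
graceful₀ : ∀ t → Graceful (C5^ (20 + 4 * t))
graceful₀ t = langford⇒graceful {17 + 4 * t} (valid⇒langford family0-valid t)

nearGraceful₁ : ∀ t → NearGraceful (C5^ (21 + 4 * t))
nearGraceful₁ t = langford⇒nearGraceful {18 + 4 * t} (valid⇒langford family1-valid t)

nearGraceful₂ : ∀ t → NearGraceful (C5^ (22 + 4 * t))
nearGraceful₂ t = langford⇒nearGraceful {19 + 4 * t} (valid⇒langford family2-valid t)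

graceful₃ : ∀ t → Graceful (C5^ (23 + 4 * t))
graceful₃ t = langford⇒graceful {20 + 4 * t} (valid⇒langford family3-valid t)

large : ∀ (ρ : Fin 4) t → Claim (20 + (toℕ ρ + 4 * t))
large zero                   t = claim-graceful (inj₁ ([20+r+4t]%4 0 t)) (graceful₀ t)
large (suc zero)             t = claim-near (inj₁ ([20+r+4t]%4 1 t)) (nearGraceful₁ t)
large (suc (suc zero))       t = claim-near (inj₂ ([20+r+4t]%4 2 t)) (nearGraceful₂ t)
large (suc (suc (suc zero))) t = claim-graceful (inj₂ ([20+r+4t]%4 3 t)) (graceful₃ t)

fromDivMod : ∀ {m} → DivMod m 4 → Claim (20 + m)
fromDivMod (result t ρ refl) = subst (λ x → Claim (20 + (toℕ ρ + x))) (*-comm 4 t) (large ρ t)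

fromOffset : ∀ {p} → (∃ λ m → 20 + m ≡ p) → Claim p
fromOffset (m , refl) = fromDivMod (m divMod 4)

theorem3p5 : (p : ℕ) → 1 ≤ p →
    ((p % 4 ≡ 1 ⊎ p % 4 ≡ 2) → NearGraceful (C5^ p)) ×
    ((p % 4 ≡ 0 ⊎ p % 4 ≡ 3) → Graceful (C5^ p))
theorem3p5 (suc p) _ =
  -- The four families begin at p = 20, 21, 22, 23; the 19 smaller values are looked up in `small`.
  [ (λ 20≤p → fromOffset (m≤n⇒∃[o]m+o≡n 20≤p))
  , (λ p<20 → All.lookup small (∈-applyUpTo⁺ suc (s≤s⁻¹ p<20)))
  ]′ (≤-<-connex 20 (suc p))
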